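{- Let $t\neq 0$. For every integer $n\ge 0$, $$\sum_{k=0}^n \frac{(-1)^k}{t^k} \left(L_{k+1} +(t-2)F_{k}\right) = \frac{(-1)^n}{t^n}F_{n+1},$$ where $F_k$ and $L_k$ are the $k$th Fibonacci and Lucas numbers.
   Context: The Fibonacci numbers $F_k$ and Lucas numbers $L_k$ ($k\ge 0$) both satisfy $x_{n+2}=x_{n+1}+x_n$ for $n\ge 0$, with initial values $F_0=0$, $F_1=1$ and $L_0=2$, $L_1=1$. Here $t$ is an indeterminate, which may be specialized to any nonzero complex number. -}

module Defs where

open import Data.Nat.Base as ℕ using (ℕ; zero; suc)
open import Data.Product.Base using (proj₁)
open import Algebra.Bundles using (CommutativeRing)
open import Algebra.Apartness.Bundles using (HeytingCommutativeRing; HeytingField)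
import Algebra.Apartness.Properties.HeytingCommutativeRing as HCR
import Algebra.Properties.Semiring.Exp as Exp
import Algebra.Properties.Semiring.Mult as Mult
import Algebra.Properties.Semiring.Sum as Sum

F : ℕ → ℕ
F 0             = 0
F 1             = 1
F (suc (suc n)) = F (suc n) ℕ.+ F n

L : ℕ → ℕ
L 0             = 2
L 1             = 1
L (suc (suc n)) = L (suc n) ℕ.+ L n

module FieldNotation {c ℓ₁ ℓ₂} (K : HeytingField c ℓ₁ ℓ₂) where

  open HeytingField K
  open CommutativeRing (HeytingCommutativeRing.commutativeRing heytingCommutativeRing)
    using (semiring)
  open HCR heytingCommutativeRing using (1#0; x#0y#0→xy#0)

  open Exp semiring public using (_^_)
  open Mult semiring using (_×_)
  open Sum semiring public using (sum⁺-syntax)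

  -- The image of a natural number in K.
  ⟦_⟧ : ℕ → Carrier
  ⟦ n ⟧ = n × 1#

  -- Division by a nonzero element.  The library's #⇒invertible inverts
  -- y - 0#, which is y up to _≈_.
  infixl 7 _/_[_]

  _/_[_] : Carrier → (y : Carrier) → y # 0# → Carrier
  x / y [ y#0 ] = x * proj₁ (#⇒invertible y#0)

  ^#0 : ∀ {x} → x # 0# → ∀ k → x ^ k # 0#
  ^#0 x#0 zero    = 1#0
  ^#0 x#0 (suc k) = x#0y#0→xy#0 x#0 (^#0 x#0 k)

{-# OPTIONS --safe #-}

-- Write c k = (-1)^k / t^k.  The sum telescopes: since c n = - t c (n+1) and
-- L (n+2) = 2 F (n+1) + F (n+2), adding the (n+1)-st summand to c n F (n+1)
-- leaves c (n+1) F (n+2).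

module Submission where

open import Defs
open import Data.Nat.Base as ℕ using (ℕ; zero; suc)
open import Data.Nat.Solver using (module +-*-Solver)
open import Data.Fin.Base using (toℕ)
open import Data.Fin.Properties using (toℕ-inject₁; toℕ-fromℕ)
open import Data.Product.Base using (_,_)
open import Algebra.Bundles using (CommutativeRing)
open import Algebra.Apartness.Bundles using (HeytingField; HeytingCommutativeRing)
import Algebra.Apartness.Properties.HeytingCommutativeRing as HCR
import Algebra.Properties.Group as GroupProperties
import Algebra.Properties.Monoid.Sum as MonoidSum
import Algebra.Properties.Ring as RingProperties
import Algebra.Properties.Semiring.Mult as Mult
import Algebra.Properties.CommutativeSemigroup as CommutativeSemigroupProperties
import Relation.Binary.Reasoning.Setoid as SetoidReasoning
open import Relation.Binary.PropositionalEquality as ≡ using (_≡_)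

-- Since L_{k+1} = 2 F_k + F_{k+1}, the second factor of each summand is t F_k + F_{k+1}
-- (`weight≈t*⟦F[n]⟧+⟦F[1+n]⟧`). Since t c_k = - c_{k-1} (`coeff-suc`), the k-th summand for k ≥ 1
-- is c_k F_{k+1} - c_{k-1} F_k, a difference of consecutive values of the claimed closed form. The
-- summand at k = 0 is c_0 F_1 because F_0 = 0, so only the top term c_n F_{n+1} survives.

-- Both sides obey the Fibonacci recurrence in `n`, so agreement at 0 and 1 suffices.
L[1+n]≡2F[n]+F[1+n] : ∀ n → L (suc n) ≡ 2 ℕ.* F n ℕ.+ F (suc n)
L[1+n]≡2F[n]+F[1+n] 0             = ≡.refl
L[1+n]≡2F[n]+F[1+n] 1             = ≡.refl
L[1+n]≡2F[n]+F[1+n] (suc (suc n)) = ≡.trans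
  (≡.cong₂ ℕ._+_ (L[1+n]≡2F[n]+F[1+n] (suc n)) (L[1+n]≡2F[n]+F[1+n] n))
  (solve 2 (λ a b → (con 2 :* a :+ (a :+ b)) :+ (con 2 :* b :+ a)
                    := con 2 :* (a :+ b) :+ ((a :+ b) :+ a))
         ≡.refl (F (suc n)) (F n))
  where open +-*-Solver

module _ {c ℓ₁ ℓ₂} (K : HeytingField c ℓ₁ ℓ₂) where

  open HeytingField K
  open FieldNotation K
  open CommutativeRing (HeytingCommutativeRing.commutativeRing heytingCommutativeRing)
    using (ring; semiring; +-monoid; +-group; *-commutativeSemigroup)
  open HCR heytingCommutativeRing using (x-0≈x)
  open GroupProperties +-group using (\\-leftDividesʳ; ⁻¹-involutive; //-rightDividesˡ)
  open RingProperties ring using (-‿distribˡ-*; -‿distribʳ-*; -1*x≈-x)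
  open Mult semiring using (×-homo-+; ×1-homo-*)
  open CommutativeSemigroupProperties *-commutativeSemigroup using (x∙yz≈y∙xz; xy∙z≈y∙xz)
  open MonoidSum +-monoid using (sum-cong-≗; sum-init-last)
  open SetoidReasoning setoid

  -- The sum unfolds from its first term, while the induction on `n` must split off the last. Taking
  -- `g` on ℕ lets the `Fin` embeddings disappear under `toℕ`.
  sum-snoc : ∀ (g : ℕ → Carrier) n →
             ∑[ i ≤ suc n ] g (toℕ i) ≈ (∑[ i ≤ n ] g (toℕ i)) + g (suc n)
  sum-snoc g n = trans (sum-init-last {suc n} (λ i → g (toℕ i)))
    (+-cong (reflexive (sum-cong-≗ {suc n} (λ i → ≡.cong g (toℕ-inject₁ i))))
            (reflexive (≡.cong g (toℕ-fromℕ (suc n)))))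

  y*[x/y]≈x : ∀ x {y} (y#0 : y # 0#) → y * (x / y [ y#0 ]) ≈ x
  y*[x/y]≈x x {y} y#0 with #⇒invertible y#0
  ... | y⁻¹ , _ , [y-0]*y⁻¹≈1 = begin
    y * (x * y⁻¹)          ≈⟨ x∙yz≈y∙xz y x y⁻¹ ⟩
    x * (y * y⁻¹)          ≈⟨ *-congˡ (*-congʳ (x-0≈x y)) ⟨
    x * ((y - 0#) * y⁻¹)   ≈⟨ *-congˡ [y-0]*y⁻¹≈1 ⟩
    x * 1#                 ≈⟨ *-identityʳ x ⟩
    x                      ∎

  -- Uniqueness of quotients. It allows equations between fractions to be checked after clearing
  -- denominators, for any proof of apartness.
  y*z≈x⇒x/y≈z : ∀ {x y z} (y#0 : y # 0#) → y * z ≈ x → x / y [ y#0 ] ≈ z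
  y*z≈x⇒x/y≈z {x} {y} {z} y#0 y*z≈x with #⇒invertible y#0
  ... | y⁻¹ , y⁻¹*[y-0]≈1 , _ = begin
    x * y⁻¹                ≈⟨ *-comm x y⁻¹ ⟩
    y⁻¹ * x                ≈⟨ *-congˡ y*z≈x ⟨
    y⁻¹ * (y * z)          ≈⟨ *-assoc y⁻¹ y z ⟨
    y⁻¹ * y * z            ≈⟨ *-congʳ (*-congˡ (x-0≈x y)) ⟨
    y⁻¹ * (y - 0#) * z     ≈⟨ *-congʳ y⁻¹*[y-0]≈1 ⟩
    1# * z                 ≈⟨ *-identityˡ z ⟩
    z                      ∎

  ⟦L[1+n]⟧≈2⟦F[n]⟧+⟦F[1+n]⟧ : ∀ n → ⟦ L (suc n) ⟧ ≈ ⟦ 2 ⟧ * ⟦ F n ⟧ + ⟦ F (suc n) ⟧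
  ⟦L[1+n]⟧≈2⟦F[n]⟧+⟦F[1+n]⟧ n = begin
    ⟦ L (suc n) ⟧                     ≡⟨ ≡.cong ⟦_⟧ (L[1+n]≡2F[n]+F[1+n] n) ⟩
    ⟦ 2 ℕ.* F n ℕ.+ F (suc n) ⟧       ≈⟨ ×-homo-+ 1# (2 ℕ.* F n) (F (suc n)) ⟩
    ⟦ 2 ℕ.* F n ⟧ + ⟦ F (suc n) ⟧     ≈⟨ +-congʳ (×1-homo-* 2 (F n)) ⟩
    ⟦ 2 ⟧ * ⟦ F n ⟧ + ⟦ F (suc n) ⟧   ∎

  module _ (t : Carrier) (t#0 : t # 0#) where

    coeff : ℕ → Carrier
    coeff k = ((- 1#) ^ k) / (t ^ k) [ ^#0 t#0 k ]

    weight : ℕ → Carrier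
    weight k = ⟦ L (suc k) ⟧ + (t - ⟦ 2 ⟧) * ⟦ F k ⟧

    -- Clearing the denominator `t ^ n` turns the right side into - (-1)^{n+1} = (-1)^n, so the
    -- inverses of `t ^ n` and `t ^ suc n` never have to be compared.
    coeff-suc : ∀ n → coeff n ≈ - (t * coeff (suc n))
    coeff-suc n = y*z≈x⇒x/y≈z (^#0 t#0 n) (begin
      t ^ n * - (t * coeff (suc n))     ≈⟨ -‿distribʳ-* (t ^ n) _ ⟨
      - (t ^ n * (t * coeff (suc n)))   ≈⟨ -‿cong (xy∙z≈y∙xz t (t ^ n) _) ⟨
      - (t ^ suc n * coeff (suc n))     ≈⟨ -‿cong (y*[x/y]≈x _ (^#0 t#0 (suc n))) ⟩
      - (- 1# * (- 1#) ^ n)             ≈⟨ -‿cong (-1*x≈-x _) ⟩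
      - - ((- 1#) ^ n)                  ≈⟨ ⁻¹-involutive _ ⟩
      (- 1#) ^ n                        ∎)

    -- The - 2 in the coefficient of F_n absorbs the 2 F_n contained in L_{n+1}.
    weight≈t*⟦F[n]⟧+⟦F[1+n]⟧ : ∀ n → weight n ≈ t * ⟦ F n ⟧ + ⟦ F (suc n) ⟧
    weight≈t*⟦F[n]⟧+⟦F[1+n]⟧ n = begin
      ⟦ L (suc n) ⟧ + (t - ⟦ 2 ⟧) * f       ≈⟨ +-congʳ (⟦L[1+n]⟧≈2⟦F[n]⟧+⟦F[1+n]⟧ n) ⟩
      (⟦ 2 ⟧ * f + g) + (t - ⟦ 2 ⟧) * f     ≈⟨ +-comm _ _ ⟩
      (t - ⟦ 2 ⟧) * f + (⟦ 2 ⟧ * f + g)     ≈⟨ +-assoc _ _ _ ⟨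
      ((t - ⟦ 2 ⟧) * f + ⟦ 2 ⟧ * f) + g     ≈⟨ +-congʳ (distribʳ f _ _) ⟨
      (t - ⟦ 2 ⟧ + ⟦ 2 ⟧) * f + g           ≈⟨ +-congʳ (*-congʳ (//-rightDividesˡ ⟦ 2 ⟧ t)) ⟩
      t * f + g                             ∎
      where
      f = ⟦ F n ⟧
      g = ⟦ F (suc n) ⟧

    telescope : ∀ n → coeff n * ⟦ F (suc n) ⟧ + coeff (suc n) * weight (suc n)
                      ≈ coeff (suc n) * ⟦ F (suc (suc n)) ⟧
    telescope n = begin
      coeff n * f + c′ * weight (suc n)     ≈⟨ +-cong (*-congʳ (coeff-suc n)) (*-congˡ (weight≈t*⟦F[n]⟧+⟦F[1+n]⟧ (suc n))) ⟩
      - (t * c′) * f + c′ * (t * f + g)     ≈⟨ +-cong (sym (-‿distribˡ-* _ f)) (distribˡ c′ _ _) ⟩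
      - (t * c′ * f) + (c′ * (t * f) + c′ * g)     ≈⟨ +-congʳ (-‿cong (xy∙z≈y∙xz t c′ f)) ⟩
      -- The previous partial sum is now the negative of the t F_{n+1} part of the new summand, and
      -- the two cancel.
      - (c′ * (t * f)) + (c′ * (t * f) + c′ * g)   ≈⟨ \\-leftDividesʳ _ _ ⟩
      c′ * g                                ∎
      where
      c′ = coeff (suc n)
      f = ⟦ F (suc n) ⟧
      g = ⟦ F (suc (suc n)) ⟧

    sum-coeff*weight : ∀ n → ∑[ i ≤ n ] (coeff (toℕ i) * weight (toℕ i))
                             ≈ coeff n * ⟦ F (suc n) ⟧
    sum-coeff*weight zero = begin
      coeff 0 * weight 0 + 0#                  ≈⟨ +-identityʳ _ ⟩
      coeff 0 * weight 0                       ≈⟨ *-congˡ (weight≈t*⟦F[n]⟧+⟦F[1+n]⟧ 0) ⟩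
      -- `⟦ F 0 ⟧` reduces to `0#`, which removes `t` from the first summand.
      coeff 0 * (t * 0# + ⟦ 1 ⟧)               ≈⟨ *-congˡ (+-congʳ (zeroʳ t)) ⟩
      coeff 0 * (0# + ⟦ 1 ⟧)                   ≈⟨ *-congˡ (+-identityˡ _) ⟩
      coeff 0 * ⟦ 1 ⟧                          ∎
    sum-coeff*weight (suc n) = begin
      ∑[ i ≤ suc n ] (coeff (toℕ i) * weight (toℕ i))
        ≈⟨ sum-snoc (λ k → coeff k * weight k) n ⟩
      (∑[ i ≤ n ] (coeff (toℕ i) * weight (toℕ i))) + coeff (suc n) * weight (suc n)
        ≈⟨ +-congʳ (sum-coeff*weight n) ⟩
      coeff n * ⟦ F (suc n) ⟧ + coeff (suc n) * weight (suc n)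
        ≈⟨ telescope n ⟩
      coeff (suc n) * ⟦ F (suc (suc n)) ⟧
        ∎

mainTheorem3 : ∀ {c ℓ₁ ℓ₂} (K : HeytingField c ℓ₁ ℓ₂) →
    let open HeytingField K
        open FieldNotation K
    in (t : Carrier) (t#0 : t # 0#) (n : ℕ) →
       (∑[ i ≤ n ] (let k = toℕ i in
          (((- 1#) ^ k) / (t ^ k) [ ^#0 t#0 k ]) * (⟦ L (suc k) ⟧ + (t - ⟦ 2 ⟧) * ⟦ F k ⟧)))
       ≈ ((((- 1#) ^ n) / (t ^ n) [ ^#0 t#0 n ]) * ⟦ F (suc n) ⟧)
mainTheorem3 = sum-coeff*weight
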